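{- Let $P_n$ be a path of length $n$, let $uv$ be an edge of $P_n$, and let $P'_n$ be the graph obtained from $P_n$ by removing the edge $uv$ (keeping all vertices). Degrees are taken in $P_n$. Then: (a) if $\deg(u)=\deg(v)=1$, then $meg(P'_n)=0$; (b) if $\deg(u)=1$ and $\deg(v)=2$, then $meg(P'_n)=meg(P_n)=2$; (c) if $\deg(u)=\deg(v)=2$, then $meg(P'_n)=meg(P_n)+2=4$.
   Context: Graphs are finite, undirected and simple. In a connected graph $H$, an edge $e$ is monitored by a pair of vertices $x,y$ if $e$ lies on all shortest paths between $x$ and $y$. A set $M\subseteq V(H)$ is a monitoring edge-geodetic set (MEG-set) of $H$ if every edge of $H$ is monitored by some pair of vertices of $M$; $meg(H)$ is the minimum size of a MEG-set of $H$. For a disconnected graph, a MEG-set is the union of MEG-sets of its connected components, where the MEG-set of an isolated vertex is taken to be empty; so $meg$ is the sum of the $meg$ of the components, an isolated vertex contributing $0$. -}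

module Defs where

open import Data.Empty using (⊥)
open import Data.Fin using (Fin; toℕ)
open import Data.Fin.Properties using (_≟_)
open import Data.Fin.Subset using (Subset; _∈_; _∉_; ∣_∣)
open import Data.List using (List; []; _∷_)
open import Data.List.Relation.Unary.Unique.Propositional using (Unique)
open import Data.Nat using (ℕ; suc; _≤_)
open import Data.Nat.Properties using (≤-antisym; m≢1+n+m)
  renaming (_≟_ to _≟ℕ_)
open import Data.Product using (∃; ∃₂; ∃-syntax; _×_; _,_; proj₁)
open import Data.Sum using (_⊎_; inj₁; inj₂; swap; [_,_]′)
open import Data.Vec using (tabulate)
open import Function using (_on_)
open import Function.Bundles using (_⇔_)
open import Level using (0ℓ)
open import Relation.Binary.Construct.Closure.ReflexiveTransitive using (Star; ε; _◅_)
open import Relation.Binary.Core using (Rel)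
open import Relation.Binary.Definitions using (Symmetric; Irreflexive; Decidable)
open import Relation.Binary.PropositionalEquality using (_≡_; refl)
open import Relation.Nullary using (¬_; does)
open import Relation.Nullary.Decidable using (_×-dec_; _⊎-dec_; ¬?)
open import Relation.Unary using (Pred)

-- Adjacency is decidable so that degrees and components of a finite graph
-- (as `Subset`s) exist constructively.
record Graph (V : Set) : Set₁ where
  field
    _~_      : Rel V 0ℓ
    ~-sym    : Symmetric _~_
    ~-irrefl : Irreflexive _≡_ _~_
    _~?_     : Decidable _~_

open Graph public using () renaming (_~_ to Adj)

-- The unordered pairs {a , b} and {c , d} coincide.
SameEdge : {V : Set} → V → V → V → V → Set
SameEdge a b c d = (a ≡ c × b ≡ d) ⊎ (a ≡ d × b ≡ c)

module _ {V : Set} (G : Graph V) where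
  open Graph G

  Walk : V → V → Set
  Walk = Star _~_

  length : ∀ {x y} → Walk x y → ℕ
  length ε       = 0
  length (_ ◅ w) = suc (length w)

  vertices : ∀ {x y} → Walk x y → List V
  vertices {x} ε       = x ∷ []
  vertices {x} (_ ◅ w) = x ∷ vertices w

  IsPath : ∀ {x y} → Walk x y → Set
  IsPath w = Unique (vertices w)

  IsShortestPath : ∀ {x y} → Walk x y → Set
  IsShortestPath {x} {y} p = IsPath p × ((q : Walk x y) → IsPath q → length p ≤ length q)

  LiesOn : V → V → ∀ {x y} → Walk x y → Set
  LiesOn a b ε                   = ⊥
  LiesOn a b (_◅_ {x} {z} _ w) = SameEdge a b x z ⊎ LiesOn a b w

  -- The edge ab is monitored by the pair x, y.
  Monitors : V → V → V → V → Set
  Monitors x y a b = (p : Walk x y) → IsShortestPath p → LiesOn a b p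

  -- Only meant for connected G: between different components `Monitors`
  -- would hold vacuously.
  IsMEGSetConnected : Pred V 0ℓ → Set
  IsMEGSetConnected M =
    ∀ a b → a ~ b → ∃₂ λ x y → M x × M y × Monitors x y a b

  Isolated : V → Set
  Isolated v = ∀ w → ¬ (v ~ w)

module _ {n : ℕ} (G : Graph (Fin n)) where
  open Graph G

  degree : Fin n → ℕ
  degree v = ∣ tabulate (λ w → does (v ~? w)) ∣

  induced : (C : Subset n) → Graph (∃ (_∈ C))
  induced C = record
    { _~_      = _~_ on proj₁
    ; ~-sym    = ~-sym
    ; ~-irrefl = λ { refl → ~-irrefl refl }
    ; _~?_     = λ x y → proj₁ x ~? proj₁ y
    }

  IsComponent : Subset n → Set
  IsComponent C = ∃[ x ] (∀ y → y ∈ C ⇔ Walk G x y)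

  -- M is a union of MEG-sets of the components, i.e. it meets each component
  -- in a MEG-set of that component, the one of an isolated vertex being empty.
  IsMEGSet : Subset n → Set
  IsMEGSet M =
    (∀ C → IsComponent C → IsMEGSetConnected (induced C) (λ v → proj₁ v ∈ M))
    × (∀ v → Isolated G v → v ∉ M)

  -- meg(G) = k.
  IsMeg : ℕ → Set
  IsMeg k = (∃[ M ] (IsMEGSet M × ∣ M ∣ ≡ k)) × (∀ M → IsMEGSet M → k ≤ ∣ M ∣)

  IsMeg-unique : ∀ {k l} → IsMeg k → IsMeg l → k ≡ l
  IsMeg-unique ((M , m , refl) , k≤) ((N , n , refl) , l≤) = ≤-antisym (k≤ N n) (l≤ M m)

  removeEdge : Fin n → Fin n → Graph (Fin n)
  removeEdge u v = record
    { _~_      = λ x y → x ~ y × ¬ SameEdge x y u v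
    ; ~-sym    = λ { (x~y , ne) → ~-sym x~y ,
                     λ { (inj₁ (p , q)) → ne (inj₂ (q , p))
                       ; (inj₂ (p , q)) → ne (inj₁ (q , p)) } }
    ; ~-irrefl = λ { x≡y (x~y , _) → ~-irrefl x≡y x~y }
    ; _~?_     = λ x y → (x ~? y) ×-dec
                   ¬? (((x ≟ u) ×-dec (y ≟ v)) ⊎-dec ((x ≟ v) ×-dec (y ≟ u)))
    }

-- Length counts edges, so the path of length n has n + 1 vertices.
path : (n : ℕ) → Graph (Fin (suc n))
path n = record
  { _~_      = λ x y → toℕ y ≡ suc (toℕ x) ⊎ toℕ x ≡ suc (toℕ y)
  ; ~-sym    = swap
  ; ~-irrefl = λ { refl → [ m≢1+n+m _ {0} , m≢1+n+m _ {0} ]′ }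
  ; _~?_     = λ x y → (toℕ y ≟ℕ suc (toℕ x)) ⊎-dec (toℕ x ≟ℕ suc (toℕ y))
  }

{-# OPTIONS --safe #-}
module Submission where

-- A leaf is an endpoint of every path through its edge, so it belongs to every
-- MEG-set. Conversely, in a subgraph of a path, walking away from an edge in both
-- directions ends at two leaves, and every walk between them crosses that edge.
-- Hence meg is the number of leaves there. Removing the edge uv lowers the degrees
-- of u and v by one and keeps all others, so an end of degree 1 stops being a
-- leaf and an end of degree 2 becomes one.

open import Data.Fin using (Fin; zero; suc; toℕ; fromℕ; inject₁; lower₁) renaming (_<_ to _<ᶠ_; _>_ to _>ᶠ_)
open import Data.Fin.Induction using (<-wellFounded; >-wellFounded)
open import Data.Fin.Properties using (_≟_; any?; toℕ-injective; toℕ<n; toℕ-fromℕ; toℕ-inject₁; toℕ-lower₁)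
open import Data.Fin.Subset using (Subset; inside; outside; ⊥; ⁅_⁆; _∪_; _∈_; _∉_; ∣_∣)
open import Data.Fin.Subset.Properties
  using (_∈?_; nonempty?; Empty-unique; ∣⊥∣≡0; ∉⊥; x∈⁅x⁆; x∈⁅y⁆⇒x≡y; ∣⁅x⁆∣≡1; x∈p∪q⁻; p⊆p∪q; q⊆p∪q;
         ⊆-antisym; drop-there; p⊆q⇒∣p∣≤∣q∣; p⊂q⇒∣p∣<∣q∣)
open import Data.List.Membership.Propositional using () renaming (_∈_ to _∈ₗ_)
open import Data.List.Relation.Unary.All as All using ()
open import Data.List.Relation.Unary.All.Properties using (¬Any⇒All¬)
import Data.List.Membership.DecPropositional as DecMembership
open import Data.List.Relation.Unary.AllPairs using ([]; _∷_)
open import Data.List.Relation.Unary.Any using (here; there)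
open import Data.Nat using (ℕ; zero; suc; _+_; _≤_; _<_; s≤s; _≤?_)
import Data.Nat as ℕ
open import Data.Nat.Properties
  using (suc-injective; ≮⇒≥; ≤-trans; ≤-antisym; ≤-reflexive;
         <-trans; <-irrefl; <-asym; <⇒≤; <⇒≱; <⇒≢; ≰⇒>; n<1+n; m<n⇒m<1+n; <-≤-trans)
open import Data.Product using (∃; ∃₂; _×_; ∃-syntax; _,_; proj₁; proj₂; swap)
open import Data.Sum using (_⊎_; inj₁; inj₂; [_,_]′) renaming (swap to ⊎-swap; map to ⊎-map)
open import Data.Vec using ([]; _∷_; here; there; tabulate)
open import Data.Vec.Properties using (lookup⇒[]=; []=⇒lookup; lookup∘tabulate)
open import Data.Vec.Properties.WithK using ([]=-irrelevant)
open import Function using (_∘_; case_of_)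
open import Function.Bundles using (_⇔_; mk⇔; Equivalence)
open import Induction.WellFounded using (WellFounded; Acc; acc)
open import Relation.Binary.Construct.Closure.ReflexiveTransitive using (ε; _◅_; _◅◅_; reverse)
open import Relation.Binary.Core using (Rel)
open import Relation.Binary.Definitions using (DecidableEquality; Transitive)
open import Relation.Binary.PropositionalEquality
  using (_≡_; _≢_; refl; sym; trans; cong; subst)
open import Relation.Nullary using (¬_; yes; no; does; contradiction)
open import Relation.Nullary.Decidable
  using (_×-dec_; ¬?; dec-true; decidable-stable; ¬¬-excluded-middle)
open import Relation.Unary using (Pred; Decidable)
open import Level using (0ℓ)
open import Defs

open Equivalence using (to; from)

private
  variable
    V : Set
    n : ℕ

-- Cardinalities of subsets

∈-tabulate : {P : Pred (Fin n) 0ℓ} (P? : Decidable P) →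
             ∀ {x} → x ∈ tabulate (does ∘ P?) ⇔ P x
∈-tabulate P? {x} = mk⇔ sound complete
  where
  sound : x ∈ tabulate (does ∘ P?) → _
  sound x∈ with P? x | trans (sym (lookup∘tabulate (does ∘ P?) x)) ([]=⇒lookup x∈)
  ... | yes Px | _ = Px
  ... | no _   | ()
  complete : _ → x ∈ tabulate (does ∘ P?)
  complete Px = lookup⇒[]= x _ (trans (lookup∘tabulate (does ∘ P?) x) (dec-true (P? x) Px))

-- Phrased by agreement off `x`, not as an equation between subsets, since the neighbourhoods and
-- leaf sets compared later are tabulated from decision procedures.
∣adjoin∣ : ∀ {p q : Subset n} x → x ∉ p → x ∈ q →
           (∀ {y} → y ≢ x → y ∈ p ⇔ y ∈ q) → ∣ q ∣ ≡ suc ∣ p ∣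
∣adjoin∣ {p = inside ∷ _} zero x∉p _ _ = contradiction here x∉p
∣adjoin∣ {p = outside ∷ p} {inside ∷ q} zero _ here p⇔q = cong (suc ∘ ∣_∣) (⊆-antisym
  (λ y∈q → drop-there (from (p⇔q λ ()) (there y∈q)))
  (λ y∈p → drop-there (to (p⇔q λ ()) (there y∈p))))
∣adjoin∣ {p = s ∷ p} {t ∷ q} (suc x) x∉p (there x∈q) p⇔q
  with s | t | ∣adjoin∣ x (x∉p ∘ there) x∈q (λ {y} y≢x →
         mk⇔ (λ y∈p → drop-there (to (p⇔q {suc y} λ { refl → y≢x refl }) (there y∈p)))
             (λ y∈q → drop-there (from (p⇔q {suc y} λ { refl → y≢x refl }) (there y∈q))))
       | p⇔q {zero} (λ ())
... | inside  | inside  | eq | _   = cong suc eq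
... | outside | outside | eq | _   = eq
... | inside  | outside | _  | 0⇔0 with () ← to 0⇔0 here
... | outside | inside  | _  | 0⇔0 with () ← from 0⇔0 here

AgreeOff : Fin n → Fin n → Subset n → Subset n → Set
AgreeOff u v p q = ∀ {y} → y ≢ u → y ≢ v → y ∈ p ⇔ y ∈ q

AgreeOff-sym : ∀ {u v : Fin n} {p q} → AgreeOff u v p q → AgreeOff u v q p
AgreeOff-sym p⇔q y≢u y≢v = mk⇔ (from (p⇔q y≢u y≢v)) (to (p⇔q y≢u y≢v))

∣adjoin-two∣ : ∀ {u v} {p q : Subset n} → u ≢ v → u ∉ p → v ∉ p → u ∈ q → v ∈ q →
               AgreeOff u v p q → ∣ q ∣ ≡ 2 + ∣ p ∣
∣adjoin-two∣ {u = u} {v} {p} {q} u≢v u∉p v∉p u∈q v∈q p⇔q =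
  trans (∣adjoin∣ u u∉p+v u∈q p+v⇔q)
        (cong suc (∣adjoin∣ v v∉p (q⊆p∪q p _ (x∈⁅x⁆ v)) p⇔p+v))
  where
  p⇔p+v : ∀ {y} → y ≢ v → y ∈ p ⇔ y ∈ p ∪ ⁅ v ⁆
  p⇔p+v y≢v = mk⇔ (p⊆p∪q _) λ y∈ → case x∈p∪q⁻ p _ y∈ of λ where
    (inj₁ y∈p) → y∈p
    (inj₂ y∈v) → contradiction (x∈⁅y⁆⇒x≡y v y∈v) y≢v
  u∉p+v : u ∉ p ∪ ⁅ v ⁆
  u∉p+v = u∉p ∘ from (p⇔p+v u≢v)
  p+v⇔q : ∀ {y} → y ≢ u → y ∈ p ∪ ⁅ v ⁆ ⇔ y ∈ q
  p+v⇔q {y} y≢u with y ≟ v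
  ... | yes refl = mk⇔ (λ _ → v∈q) (λ _ → q⊆p∪q p _ (x∈⁅x⁆ v))
  ... | no y≢v   = mk⇔ (to (p⇔q y≢u y≢v) ∘ from (p⇔p+v y≢v)) (to (p⇔p+v y≢v) ∘ from (p⇔q y≢u y≢v))

-- Both subsets are one element short of `p ∪ q`: `p` lacks only `v`, and `q` lacks only `u`.
∣exchange∣ : ∀ {u v} {p q : Subset n} → u ∈ p → v ∉ p → u ∉ q → v ∈ q →
             AgreeOff u v p q → ∣ p ∣ ≡ ∣ q ∣
∣exchange∣ {u = u} {v} {p} {q} u∈p v∉p u∉q v∈q p⇔q = suc-injective (trans
  (sym (∣adjoin∣ v v∉p (q⊆p∪q p q v∈q) λ {y} y≢v → mk⇔ (p⊆p∪q q) λ y∈ →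
    case ((y ≟ u) , x∈p∪q⁻ p q y∈) of λ where
      (_ , inj₁ y∈p)         → y∈p
      (yes refl , inj₂ _)    → u∈p
      (no y≢u , inj₂ y∈q)    → from (p⇔q y≢u y≢v) y∈q))
  (∣adjoin∣ u u∉q (p⊆p∪q q u∈p) λ {y} y≢u → mk⇔ (q⊆p∪q p q) λ y∈ →
    case ((y ≟ v) , x∈p∪q⁻ p q y∈) of λ where
      (_ , inj₂ y∈q)         → y∈q
      (yes refl , inj₁ _)    → v∈q
      (no y≢v , inj₁ y∈p)    → to (p⇔q y≢u y≢v) y∈p))

∣p∣≡1⇒∃! : ∀ {p : Subset n} → ∣ p ∣ ≡ 1 → ∃[ x ] (x ∈ p × (∀ {y} → y ∈ p → y ≡ x))
∣p∣≡1⇒∃! {n} {p} ∣p∣≡1 with nonempty? p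
... | no empty with () ← trans (sym ∣p∣≡1) (trans (cong ∣_∣ (Empty-unique empty)) (∣⊥∣≡0 n))
-- A second element `y` would make `⁅ x ⁆` a proper subset of `p`, forcing `1 < ∣ p ∣`.
... | yes (x , x∈p) = x , x∈p , λ {y} y∈p → decidable-stable (y ≟ x) λ y≢x →
  <-irrefl refl (subst (1 <_) ∣p∣≡1 (subst (_< ∣ p ∣) (∣⁅x⁆∣≡1 x) (p⊂q⇒∣p∣<∣q∣
    ( (λ z∈x → subst (_∈ p) (sym (x∈⁅y⁆⇒x≡y x z∈x)) x∈p)
    , y , y∈p , y≢x ∘ x∈⁅y⁆⇒x≡y x))))

∃!⇒∣p∣≡1 : ∀ {p : Subset n} {x} → x ∈ p → (∀ {y} → y ∈ p → y ≡ x) → ∣ p ∣ ≡ 1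
∃!⇒∣p∣≡1 {n} {x = x} x∈p unique = trans
  (∣adjoin∣ x ∉⊥ x∈p λ y≢x → mk⇔ (λ y∈⊥ → contradiction y∈⊥ ∉⊥) (λ y∈p → contradiction (unique y∈p) y≢x))
  (cong suc (∣⊥∣≡0 n))

-- `P` need not be decidable, but excluded middle is used at only finitely many points, so a double
-- negation absorbs it. It serves to form the component of a leaf.
¬¬-comprehension : (P : Pred (Fin n) 0ℓ) → ¬ ¬ (∃[ C ] (∀ y → y ∈ C ⇔ P y))
¬¬-comprehension {zero}  P ¬C = ¬C ([] , λ ())
¬¬-comprehension {suc n} P ¬C = ¬¬-comprehension (P ∘ suc) λ (C , C⇔P) →
  ¬¬-excluded-middle λ where
    (yes P0) → ¬C (inside ∷ C , λ where
      zero    → mk⇔ (λ _ → P0) (λ _ → here)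
      (suc y) → mk⇔ (to (C⇔P y) ∘ drop-there) (there ∘ from (C⇔P y)))
    (no ¬P0) → ¬C (outside ∷ C , λ where
      zero    → mk⇔ (λ ()) (λ P0 → contradiction P0 ¬P0)
      (suc y) → mk⇔ (to (C⇔P y) ∘ drop-there) (there ∘ from (C⇔P y)))

-- Paths and leaves

module _ (G : Graph V) where
  open Graph G

  -- Free of degrees, so that it makes sense over any vertex type, in particular in induced
  -- subgraphs.
  Leaf : V → V → Set
  Leaf v w = v ~ w × (∀ {z} → v ~ z → z ≡ w)

  source∈vertices : ∀ {x y} (p : Walk G x y) → x ∈ₗ vertices G p
  source∈vertices ε       = here refl
  source∈vertices (_ ◅ _) = here refl

  -- An inner vertex of a path has two distinct neighbours on it, but a leaf has only one neighbour.
  leaf-on-path⇒endpoint : ∀ {v w} → Leaf v w → ∀ {x y} (p : Walk G x y) →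
                          IsPath G p → LiesOn G v w p → v ≡ x ⊎ v ≡ y
  leaf-on-path⇒endpoint {v} {w} (_ , only-w) = go
    where
    stops : ∀ {x y} (x~v : x ~ v) (p : Walk G v y) → IsPath G (x~v ◅ p) → v ≡ y
    stops x~v ε _ = refl
    -- Entering `v` from `x` and leaving it to `z` forces `x ≡ w ≡ z`, a repeated vertex.
    stops x~v (v~z ◅ p) ((_ All.∷ x∉p) ∷ _) = contradiction
      (trans (only-w (~-sym x~v)) (sym (only-w v~z)))
      (All.lookup x∉p (source∈vertices p))

    go : ∀ {x y} (p : Walk G x y) → IsPath G p → LiesOn G v w p → v ≡ x ⊎ v ≡ y
    go (_ ◅ _) _ (inj₁ (inj₁ (v≡x , _)))  = inj₁ v≡x
    go (e ◅ p) u (inj₁ (inj₂ (refl , _))) = inj₂ (stops e p u)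
    go (e ◅ p) u@(_ ∷ u′) (inj₂ on) with go p u′ on
    ... | inj₁ refl = inj₂ (stops e p u)
    ... | inj₂ v≡y  = inj₂ v≡y

  LiesOn-swap : ∀ {a b x y} (p : Walk G x y) → LiesOn G a b p → LiesOn G b a p
  LiesOn-swap (_ ◅ p) = ⊎-map (⊎-swap ∘ ⊎-map swap swap) (LiesOn-swap p)

  suffix : ∀ {x y z} (p : Walk G x y) → IsPath G p → z ∈ₗ vertices G p → ∃ (IsPath G {z} {y})
  suffix ε       u       (here refl) = ε , u
  suffix (e ◅ p) u       (here refl) = e ◅ p , u
  suffix (_ ◅ p) (_ ∷ u) (there z∈p) = suffix p u z∈p

  -- Loop erasure: if `x` recurs on the path found for the rest of the walk, only the part from that
  -- occurrence on is kept.
  walk⇒path : DecidableEquality V → ∀ {x y} → Walk G x y → ∃ (IsPath G {x} {y})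
  walk⇒path _≟V_ ε = ε , All.[] ∷ []
  walk⇒path _≟V_ {x} (e ◅ w) with walk⇒path _≟V_ w
  ... | p , u with DecMembership._∈?_ _≟V_ x (vertices G p)
  ...   | yes x∈p = suffix p u x∈p
  ...   | no  x∉p = e ◅ p , ¬Any⇒All¬ _ x∉p ∷ u

  -- If no path were shortest, every path would have a strictly shorter one; induction on a bound
  -- `k` for the length excludes this descent.
  ¬¬-shortestPath : ∀ {x y} → ∃ (IsPath G {x} {y}) → ¬ ¬ ∃ (IsShortestPath G {x} {y})
  ¬¬-shortestPath (p , u) none = go p u (n<1+n _)
    where
    go : ∀ {k} p → IsPath G p → ¬ (length G p < k)
    go p u (s≤s p≤k) = none (p , u , λ q u′ → ≮⇒≥ λ q<p → go q u′ (<-≤-trans q<p p≤k))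

module _ (G : Graph (Fin n)) where
  open Graph G

  neighbours : Fin n → Subset n
  neighbours v = tabulate (λ w → does (v ~? w))

  leaves : Subset n
  leaves = tabulate (λ v → does (degree G v ℕ.≟ 1))

  ∈-neighbours : ∀ {v w} → w ∈ neighbours v ⇔ v ~ w
  ∈-neighbours {v} = ∈-tabulate (v ~?_)

  ∈-leaves : ∀ {v} → v ∈ leaves ⇔ degree G v ≡ 1
  ∈-leaves = ∈-tabulate (λ v → degree G v ℕ.≟ 1)

  ∈-leaves⇒Leaf : ∀ {v} → v ∈ leaves → ∃ (Leaf G v)
  ∈-leaves⇒Leaf v∈ with w , w∈ , unique ← ∣p∣≡1⇒∃! (to ∈-leaves v∈) =
    w , to ∈-neighbours w∈ , unique ∘ from ∈-neighbours

  Leaf⇒∈-leaves : ∀ {v w} → Leaf G v w → v ∈ leaves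
  Leaf⇒∈-leaves (v~w , only-w) =
    from ∈-leaves (∃!⇒∣p∣≡1 (from ∈-neighbours v~w) (only-w ∘ to ∈-neighbours))

  module _ (C : Subset n) where

    ∈C-≡ : {x y : ∃ (_∈ C)} → proj₁ x ≡ proj₁ y → x ≡ y
    ∈C-≡ {_ , x∈} {_ , y∈} refl = cong (_ ,_) ([]=-irrelevant x∈ y∈)

    ≟-C : DecidableEquality (∃ (_∈ C))
    ≟-C x y with proj₁ x ≟ proj₁ y
    ... | yes eq = yes (∈C-≡ eq)
    ... | no neq = no (neq ∘ cong proj₁)

    walk-induced : (∀ {x y} → x ∈ C → x ~ y → y ∈ C) →
                   ∀ {x y} (x∈ : x ∈ C) (y∈ : y ∈ C) → Walk G x y → Walk (induced G C) (x , x∈) (y , y∈)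
    walk-induced closed x∈ y∈ ε       = subst (Walk (induced G C) _) (∈C-≡ refl) ε
    walk-induced closed x∈ y∈ (e ◅ w) = e ◅ walk-induced closed (closed x∈ e) y∈ w

  -- Neither the component of the leaf nor a shortest path in it need be computed:
  -- membership in M is decidable, hence stable under double negation.
  leaf∈MEGSet : ∀ {M v w} → IsMEGSet G M → Leaf G v w → v ∈ M
  leaf∈MEGSet {M} {v} {w} (meg , _) (v~w , only-w) = decidable-stable (v ∈? M) λ v∉M →
    ¬¬-comprehension (Walk G v) λ (C , C⇔) →
    let
      closed : ∀ {x y} → x ∈ C → x ~ y → y ∈ C
      closed x∈ x~y = from (C⇔ _) (to (C⇔ _) x∈ ◅◅ x~y ◅ ε)
      v∈ = from (C⇔ v) ε
      w∈ = closed v∈ v~w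
      x , y , x∈M , y∈M , mon = meg C (v , C⇔) (v , v∈) (w , w∈) v~w
      -- Monitoring has content only once a shortest path from `x` to `y` exists; a walk through `v`
      -- connects them.
      x⇝y = reverse ~-sym (to (C⇔ _) (proj₂ x)) ◅◅ to (C⇔ _) (proj₂ y)
      p = walk⇒path (induced G C) (≟-C C) (walk-induced C closed (proj₂ x) (proj₂ y) x⇝y)
    in ¬¬-shortestPath (induced G C) p λ (q , shortest) →
      [ (λ v≡x → v∉M (subst (_∈ M) (sym (cong proj₁ v≡x)) x∈M))
      , (λ v≡y → v∉M (subst (_∈ M) (sym (cong proj₁ v≡y)) y∈M)) ]′
      (leaf-on-path⇒endpoint (induced G C) (v~w , λ e → ∈C-≡ C (only-w e)) q (proj₁ shortest)
        (mon q shortest))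

  -- Either `y` has no neighbour but `x` and is a leaf, or the walk moves on to some other
  -- neighbour, which `step` places further along in the same direction. Well-foundedness ends the
  -- walk. The relation is abstract so that one proof covers both directions.
  reach-leaf : {_≺_ : Rel (Fin n) 0ℓ} → WellFounded _≺_ → Transitive _≺_ →
               (∀ {x y z} → x ~ y → y ~ z → z ≢ x → y ≺ x → z ≺ y) →
               ∀ {x y} → x ~ y → y ≺ x → ∃[ l ] (l ∈ leaves × Walk G y l × l ≺ x)
  reach-leaf {_≺_} wf ≺-trans step x~y y≺x = go (wf _) x~y y≺x
    where
    go : ∀ {x y} → Acc _≺_ y → x ~ y → y ≺ x → ∃[ l ] (l ∈ leaves × Walk G y l × l ≺ x)
    go {x} {y} (acc rs) x~y y≺x with any? (λ z → (y ~? z) ×-dec ¬? (z ≟ x))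
    ... | no none = y
                  , Leaf⇒∈-leaves (~-sym x~y , λ {z} y~z → decidable-stable (z ≟ x) λ z≢x → none (z , y~z , z≢x))
                  , ε , y≺x
    ... | yes (z , y~z , z≢x) with z≺y ← step x~y y~z z≢x y≺x
      with l , l∈ , z⇝l , l≺y ← go (rs z≺y) y~z z≺y = l , l∈ , y~z ◅ z⇝l , ≺-trans l≺y y≺x

-- Subgraphs of a path

-- Subgraphs of the path on all its vertices: the path itself and the path without `uv` are both
-- instances.
Linear : Graph (Fin (suc n)) → Set
Linear G = ∀ {x y} → Adj G x y → Adj (path _) x y

module _ {G : Graph (Fin (suc n))} (linear : Linear G) where
  open Graph G

  -- In a path `y` has at most one neighbour on each side; the one above is `x`, so `z` lies below.
  descends : ∀ {x y z} → x ~ y → y ~ z → z ≢ x → y <ᶠ x → z <ᶠ y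
  descends x~y y~z z≢x y<x with linear x~y | linear y~z
  ... | inj₁ y≡1+x | _          = contradiction (≤-reflexive (sym y≡1+x)) (<-asym y<x)
  ... | inj₂ x≡1+y | inj₁ z≡1+y = contradiction (toℕ-injective (trans z≡1+y (sym x≡1+y))) z≢x
  ... | inj₂ _     | inj₂ y≡1+z = ≤-reflexive (sym y≡1+z)

  ascends : ∀ {x y z} → x ~ y → y ~ z → z ≢ x → y >ᶠ x → z >ᶠ y
  ascends x~y y~z z≢x x<y with linear x~y | linear y~z
  ... | inj₂ x≡1+y | _          = contradiction (≤-reflexive (sym x≡1+y)) (<-asym x<y)
  ... | inj₁ y≡1+x | inj₂ y≡1+z = contradiction (toℕ-injective (suc-injective (trans (sym y≡1+z) y≡1+x))) z≢x
  ... | inj₁ _     | inj₁ z≡1+y = ≤-reflexive (sym z≡1+y)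

  -- A discrete intermediate value argument: each step changes the number by one, so a walk can pass
  -- from at most `a` to beyond `a` only along the edge `ab`.
  crosses : ∀ C (a b : ∃ (_∈ C)) → toℕ (proj₁ b) ≡ suc (toℕ (proj₁ a)) →
            ∀ {x y} (p : Walk (induced G C) x y) →
            toℕ (proj₁ x) ≤ toℕ (proj₁ a) → toℕ (proj₁ a) < toℕ (proj₁ y) →
            LiesOn (induced G C) a b p
  crosses C a b b≡1+a ε x≤a a<x = contradiction x≤a (<⇒≱ a<x)
  crosses C a b b≡1+a {x} (_◅_ {j = z} x~z p) x≤a a<y with toℕ (proj₁ z) ≤? toℕ (proj₁ a)
  ... | yes z≤a = inj₂ (crosses C a b b≡1+a p z≤a a<y)
  -- This step leaves the part up to `a`. It must go up by one, so `x` is `a` and `z` is `b`.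
  ... | no z≰a with linear x~z
  ...   | inj₂ x≡1+z = contradiction
          (≤-trans (≤-trans (≤-reflexive (sym x≡1+z)) x≤a) (<⇒≤ (≰⇒> z≰a))) (<-irrefl refl)
  ...   | inj₁ z≡1+x = inj₁ (inj₁ ( ∈C-≡ G C (toℕ-injective a≡x)
                                  , ∈C-≡ G C (toℕ-injective (trans b≡1+a (trans (cong suc a≡x) (sym z≡1+x))))))
    where
    a≡x : toℕ (proj₁ a) ≡ toℕ (proj₁ x)
    a≡x = ≤-antisym (ℕ.s≤s⁻¹ (subst (toℕ (proj₁ a) <_) z≡1+x (≰⇒> z≰a))) x≤a

  leaves-isMEGSet : IsMEGSet G (leaves G)
  leaves-isMEGSet = monitored , λ v isolated v∈ → case ∈-leaves⇒Leaf G v∈ of λ (w , v~w , _) → isolated w v~w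
    where
    monitored-up : ∀ C → IsComponent G C → (a b : ∃ (_∈ C)) → proj₁ a ~ proj₁ b →
                   toℕ (proj₁ b) ≡ suc (toℕ (proj₁ a)) →
                   ∃₂ λ x y → proj₁ x ∈ leaves G × proj₁ y ∈ leaves G × Monitors (induced G C) x y a b
    monitored-up C (r , C⇔) a@(_ , a∈) b@(_ , b∈) a~b b≡1+a
      -- One leaf is reached downwards from `a`, the other upwards from `b`. As `b` is the successor
      -- of `a`, `l<b` means that `l` is at most `a`, and then every walk from `l` to `m` in `C`
      -- crosses `ab`, shortest or not.
      with l , l∈ , a⇝l , l<b ← reach-leaf G <-wellFounded <-trans descends (~-sym a~b) (≤-reflexive (sym b≡1+a))
         | m , m∈ , b⇝m , a<m ← reach-leaf G >-wellFounded (λ x>y y>z → <-trans y>z x>y) ascends a~b (≤-reflexive (sym b≡1+a))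
      = (l , from (C⇔ l) (to (C⇔ _) a∈ ◅◅ a⇝l)) , (m , from (C⇔ m) (to (C⇔ _) b∈ ◅◅ b⇝m))
      , l∈ , m∈ , λ p _ → crosses C a b b≡1+a p (ℕ.s≤s⁻¹ (subst (toℕ l <_) b≡1+a l<b)) a<m

    monitored : ∀ C → IsComponent G C → IsMEGSetConnected (induced G C) (λ v → proj₁ v ∈ leaves G)
    monitored C comp a b a~b with linear a~b
    ... | inj₁ b≡1+a = monitored-up C comp a b a~b b≡1+a
    ... | inj₂ a≡1+b with x , y , x∈ , y∈ , mon ← monitored-up C comp b a (~-sym a~b) a≡1+b =
      x , y , x∈ , y∈ , λ p shortest → LiesOn-swap (induced G C) p (mon p shortest)

  -- The leaves form a MEG-set and are contained in every MEG-set.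
  meg≡∣leaves∣ : ∀ {k} → ∣ leaves G ∣ ≡ k → IsMeg G k
  meg≡∣leaves∣ refl = (leaves G , leaves-isMEGSet , refl) ,
    λ M megM → p⊆q⇒∣p∣≤∣q∣ (λ v∈ → leaf∈MEGSet G megM (proj₂ (∈-leaves⇒Leaf G v∈)))

-- The two leaves of a path of positive length

leaf-zero : ∀ n → Leaf (path (suc n)) zero (suc zero)
leaf-zero n = inj₁ refl , λ { (inj₁ z≡1) → toℕ-injective z≡1 ; (inj₂ ()) }

leaf-fromℕ : ∀ n → Leaf (path (suc n)) (fromℕ (suc n)) (inject₁ (fromℕ n))
leaf-fromℕ n = inj₂ (cong suc (sym (toℕ-inject₁ (fromℕ n)))) , λ where
  (inj₂ 1+n≡1+z) → toℕ-injective (trans (suc-injective (sym 1+n≡1+z)) (sym (toℕ-inject₁ (fromℕ n))))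
  -- A neighbour above the last vertex would have number `2 + n`, but all numbers are smaller.
  {z} (inj₁ z≡2+n) → contradiction
    (subst (_< 2 + n) (trans z≡2+n (cong (2 +_) (toℕ-fromℕ n))) (toℕ<n z)) (<-irrefl refl)

-- The vertices just below and just above are both neighbours, and their numbers differ by two.
interior∉leaves : ∀ n {x} → x ≢ zero → x ≢ fromℕ (suc n) → x ∉ leaves (path (suc n))
interior∉leaves n {zero}  x≢0 _ _ = x≢0 refl
interior∉leaves n {suc x} _ x≢n x∈ with _ , _ , unique ← ∈-leaves⇒Leaf (path (suc n)) x∈ =
  <⇒≢ (m<n⇒m<1+n (n<1+n (toℕ x)))
    (trans (sym (toℕ-inject₁ x)) (trans (cong toℕ (trans (unique {inject₁ x} below) (sym (unique above)))) 2+x))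
  where
  -- Since `suc x` is not the last vertex, `lower₁` applies to `x`, and its double successor is the
  -- vertex above.
  n≢x : n ≢ toℕ x
  n≢x n≡x = x≢n (cong suc (toℕ-injective (trans (sym n≡x) (sym (toℕ-fromℕ n)))))
  2+x : toℕ (suc (suc (lower₁ x n≢x))) ≡ 2 + toℕ x
  2+x = cong (2 +_) (toℕ-lower₁ x n≢x)
  above : Adj (path (suc n)) (suc x) (suc (suc (lower₁ x n≢x)))
  above = inj₁ 2+x
  below : Adj (path (suc n)) (suc x) (inject₁ x)
  below = inj₂ (cong suc (sym (toℕ-inject₁ x)))

∣leaves-path∣≡2 : ∀ n → ∣ leaves (path (suc n)) ∣ ≡ 2
∣leaves-path∣≡2 n = trans
  (∣adjoin-two∣ {u = zero} {v = fromℕ (suc n)} (λ ()) ∉⊥ ∉⊥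
    (Leaf⇒∈-leaves (path (suc n)) (leaf-zero n))
    (Leaf⇒∈-leaves (path (suc n)) (leaf-fromℕ n))
    (λ y≢0 y≢n → mk⇔ (λ y∈⊥ → contradiction y∈⊥ ∉⊥)
                      (λ y∈ → contradiction y∈ (interior∉leaves n y≢0 y≢n))))
  (cong (2 +_) (∣⊥∣≡0 (suc (suc n))))

-- Removing an edge

module _ (G : Graph (Fin n)) {u v : Fin n} (u~v : Adj G u v) where
  open Graph G

  private
    G′ : Graph (Fin n)
    G′ = removeEdge G u v

  u≢v : u ≢ v
  u≢v u≡v = ~-irrefl u≡v u~v

  degree-removeEdgeˡ : degree G u ≡ suc (degree G′ u)
  degree-removeEdgeˡ = ∣adjoin∣ v
    (λ v∈ → proj₂ (to (∈-neighbours G′) v∈) (inj₁ (refl , refl)))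
    (from (∈-neighbours G) u~v)
    (λ y≢v → mk⇔
      (from (∈-neighbours G) ∘ proj₁ ∘ to (∈-neighbours G′))
      (λ y∈ → from (∈-neighbours G′) (to (∈-neighbours G) y∈ , λ where
        (inj₁ (_ , y≡v)) → y≢v y≡v
        (inj₂ (u≡v , _)) → u≢v u≡v)))

  -- Proved directly, because `removeEdge G u v` and `removeEdge G v u` are different terms and the
  -- symmetry is not definitional.
  degree-removeEdgeʳ : degree G v ≡ suc (degree G′ v)
  degree-removeEdgeʳ = ∣adjoin∣ u
    (λ u∈ → proj₂ (to (∈-neighbours G′) u∈) (inj₂ (refl , refl)))
    (from (∈-neighbours G) (~-sym u~v))
    (λ y≢u → mk⇔
      (from (∈-neighbours G) ∘ proj₁ ∘ to (∈-neighbours G′))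
      (λ y∈ → from (∈-neighbours G′) (to (∈-neighbours G) y∈ , λ where
        (inj₁ (v≡u , _)) → u≢v (sym v≡u)
        (inj₂ (_ , y≡u)) → y≢u y≡u)))

  degree-removeEdge-other : ∀ {w} → w ≢ u → w ≢ v → degree G w ≡ degree G′ w
  degree-removeEdge-other w≢u w≢v = cong ∣_∣ (⊆-antisym
    (λ y∈ → from (∈-neighbours G′) (to (∈-neighbours G) y∈ , λ where
      (inj₁ (w≡u , _)) → w≢u w≡u
      (inj₂ (w≡v , _)) → w≢v w≡v))
    (from (∈-neighbours G) ∘ proj₁ ∘ to (∈-neighbours G′)))

  leaves-removeEdge : AgreeOff u v (leaves G) (leaves G′)
  leaves-removeEdge y≢u y≢v = mk⇔
    (λ y∈ → from (∈-leaves G′) (trans (sym (degree-removeEdge-other y≢u y≢v)) (to (∈-leaves G) y∈)))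
    (λ y∈ → from (∈-leaves G) (trans (degree-removeEdge-other y≢u y≢v) (to (∈-leaves G′) y∈)))

  u-degree1⇒∉leaves′ : degree G u ≡ 1 → u ∉ leaves G′
  u-degree1⇒∉leaves′ du u∈ = case trans (sym du) (trans degree-removeEdgeˡ (cong suc (to (∈-leaves G′) u∈))) of λ ()

  v-degree1⇒∉leaves′ : degree G v ≡ 1 → v ∉ leaves G′
  v-degree1⇒∉leaves′ dv v∈ = case trans (sym dv) (trans degree-removeEdgeʳ (cong suc (to (∈-leaves G′) v∈))) of λ ()

  u-degree2⇒∈leaves′ : degree G u ≡ 2 → u ∈ leaves G′
  u-degree2⇒∈leaves′ du = from (∈-leaves G′) (suc-injective (trans (sym degree-removeEdgeˡ) du))

  v-degree2⇒∈leaves′ : degree G v ≡ 2 → v ∈ leaves G′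
  v-degree2⇒∈leaves′ dv = from (∈-leaves G′) (suc-injective (trans (sym degree-removeEdgeʳ) dv))

  degree2⇒∉leaves : ∀ {w} → degree G w ≡ 2 → w ∉ leaves G
  degree2⇒∉leaves dw w∈ = case trans (sym dw) (to (∈-leaves G) w∈) of λ ()

  ∣leaves∣-11 : degree G u ≡ 1 → degree G v ≡ 1 → ∣ leaves G ∣ ≡ 2 + ∣ leaves G′ ∣
  ∣leaves∣-11 du dv = ∣adjoin-two∣ u≢v (u-degree1⇒∉leaves′ du) (v-degree1⇒∉leaves′ dv)
    (from (∈-leaves G) du) (from (∈-leaves G) dv) (AgreeOff-sym leaves-removeEdge)

  ∣leaves∣-12 : degree G u ≡ 1 → degree G v ≡ 2 → ∣ leaves G ∣ ≡ ∣ leaves G′ ∣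
  ∣leaves∣-12 du dv = ∣exchange∣ (from (∈-leaves G) du) (degree2⇒∉leaves dv)
    (u-degree1⇒∉leaves′ du) (v-degree2⇒∈leaves′ dv) leaves-removeEdge

  ∣leaves∣-22 : degree G u ≡ 2 → degree G v ≡ 2 → ∣ leaves G′ ∣ ≡ 2 + ∣ leaves G ∣
  ∣leaves∣-22 du dv = ∣adjoin-two∣ u≢v (degree2⇒∉leaves du) (degree2⇒∉leaves dv)
    (u-degree2⇒∈leaves′ du) (v-degree2⇒∈leaves′ dv) leaves-removeEdge

-- Removing an edge from a path: the three degree cases

corollary3p2 : (n : ℕ) (u v : Fin (suc n)) → Adj (path n) u v →
    (degree (path n) u ≡ 1 → degree (path n) v ≡ 1 →
    IsMeg (removeEdge (path n) u v) 0)
    × (degree (path n) u ≡ 1 → degree (path n) v ≡ 2 →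
    ∃[ m ] (IsMeg (path n) m × IsMeg (removeEdge (path n) u v) m × m ≡ 2))
    × (degree (path n) u ≡ 2 → degree (path n) v ≡ 2 →
    ∃[ m ] (IsMeg (path n) m × IsMeg (removeEdge (path n) u v) (m + 2) × m + 2 ≡ 4))
-- The path of length 0 is a single vertex and has no edge to remove.
corollary3p2 zero    zero zero (inj₁ ())
corollary3p2 zero    zero zero (inj₂ ())
corollary3p2 (suc n) u v u~v =
    -- Both lost leaves are cancelled from `2 + ∣ leaves G′ ∣ ≡ 2`, where `G′` is the path without
    -- `uv`.
    (λ du dv → meg-removed (suc-injective (suc-injective
      (trans (sym (∣leaves∣-11 P u~v du dv)) ∣leaves∣≡2))))
  , (λ du dv → 2 , meg-path , meg-removed (trans (sym (∣leaves∣-12 P u~v du dv)) ∣leaves∣≡2) , refl)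
  , (λ du dv → 2 , meg-path , meg-removed (trans (∣leaves∣-22 P u~v du dv) (cong (2 +_) ∣leaves∣≡2)) , refl)
  where
  P = path (suc n)
  ∣leaves∣≡2 = ∣leaves-path∣≡2 n
  meg-path : IsMeg P 2
  meg-path = meg≡∣leaves∣ {G = P} (λ x~y → x~y) ∣leaves∣≡2
  meg-removed : ∀ {k} → ∣ leaves (removeEdge P u v) ∣ ≡ k → IsMeg (removeEdge P u v) k
  meg-removed = meg≡∣leaves∣ {G = removeEdge P u v} proj₁
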